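{- Suppose $(S,\to,\twoheadrightarrow,\hookrightarrow)$ is a two-acyclic factorization system and let $[(X_1,Y_1),(X_2,Y_2)]$ be an interval in $\operatorname{Pairs}(\to)$. Let $\to'$ be the restriction of $\to$ to $X_2\cap Y_1$ and let $(\twoheadrightarrow',\hookrightarrow')=\operatorname{Fact}(\to')$. Then $(X_2\cap Y_1,\to',\twoheadrightarrow',\hookrightarrow')$ is a two-acyclic factorization system. The map $(U,V)\mapsto(U\cap Y_1,V\cap X_2)$ is an isomorphism from $[(X_1,Y_1),(X_2,Y_2)]$ to $\operatorname{Pairs}(\to')$.
   Context: For a binary relation $\to$ on a set $S$ and $X\subseteq S$, put $X^\perp=\{y\in S: x\not\to y\ \forall x\in X\}$ and ${}^\perp X=\{y\in S: y\not\to x\ \forall x\in X\}$. A maximal orthogonal pair is a pair $(X,Y)$ of subsets of $S$ with $Y=X^\perp$ and $X={}^\perp Y$. $\operatorname{Pairs}(\to)$ is the complete lattice of maximal orthogonal pairs, partially ordered by containment of first components (equivalently reverse containment of second components). For a reflexive relation $\to$ on $S$, $\operatorname{Fact}(\to)=(\twoheadrightarrow,\hookrightarrow)$, where $x\twoheadrightarrow y$ iff for all $z\in S$, $y\to z$ implies $x\to z$, and $x\hookrightarrow y$ iff for all $z\in S$, $z\to x$ implies $z\to y$. For preorders $\twoheadrightarrow,\hookrightarrow$ on $S$, $\operatorname{Mult}(\twoheadrightarrow,\hookrightarrow)$ is the relation relating $x$ to $z$ iff there is $y\in S$ with $x\twoheadrightarrow y\hookrightarrow z$. A factorization system is a tuple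 $(S,\to,\twoheadrightarrow,\hookrightarrow)$ ($S$ possibly infinite) with $\to$ a reflexive relation on $S$, $\operatorname{Fact}(\to)=(\twoheadrightarrow,\hookrightarrow)$ and $\operatorname{Mult}(\twoheadrightarrow,\hookrightarrow)=\to$. It is two-acyclic if it satisfies the order condition ($x\twoheadrightarrow y\twoheadrightarrow x$ implies $x=y$, and $x\hookrightarrow y\hookrightarrow x$ implies $x=y$) and the brick condition ($x\twoheadrightarrow y\hookrightarrow x$ implies $x=y$). -}

module Defs where

open import Data.Product using (Σ; _×_; _,_; proj₁; proj₂; swap)
open import Data.Refinement using (Refinement; value)
open import Function using (_∘_; _on_; id)
open import Level using (Level; suc; _⊔_)
open import Relation.Binary using (Rel; _⇔_; Reflexive; Antisymmetric; Poset)
open import Relation.Binary.Construct.Composition using (_;_)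
import Relation.Binary.Construct.On as On
open import Relation.Binary.PropositionalEquality using (_≡_)
open import Relation.Nullary using (¬_)
open import Relation.Unary using (Pred; _∈_; _⊆_; _≐_; _∩_)

private
  variable
    ℓ : Level
    S : Set ℓ

-- Subsets of S are predicates on S, and equality of subsets is mutual
-- inclusion _≐_; equality of relations is mutual implication _⇔_.

------------------------------------------------------------------------
-- Maximal orthogonal pairs

rightPerp : {S : Set ℓ} → Rel S ℓ → Pred S ℓ → Pred S ℓ
rightPerp _⟶_ X y = ∀ x → x ∈ X → ¬ (x ⟶ y)

leftPerp : {S : Set ℓ} → Rel S ℓ → Pred S ℓ → Pred S ℓ
leftPerp _⟶_ X y = ∀ x → x ∈ X → ¬ (y ⟶ x)

record IsMaximalOrthogonalPair {S : Set ℓ} (_⟶_ : Rel S ℓ)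
                               (X Y : Pred S ℓ) : Set ℓ where
  field
    Y≐X⊥ : Y ≐ rightPerp _⟶_ X
    X≐⊥Y : X ≐ leftPerp _⟶_ Y

record MaximalOrthogonalPair {S : Set ℓ} (_⟶_ : Rel S ℓ) : Set (suc ℓ) where
  constructor mkPair
  field
    X Y       : Pred S ℓ
    isMaximal : IsMaximalOrthogonalPair _⟶_ X Y

  open IsMaximalOrthogonalPair isMaximal public

open MaximalOrthogonalPair public using (X; Y)

Pairs : {S : Set ℓ} → Rel S ℓ → Poset (suc ℓ) ℓ ℓ
Pairs _⟶_ = record
  { Carrier        = MaximalOrthogonalPair _⟶_
  ; _≈_            = λ P Q → (X P ≐ X Q) × (Y P ≐ Y Q)
  ; _≤_            = λ P Q → X P ⊆ X Q
  ; isPartialOrder = record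
    { isPreorder = record
      { isEquivalence = record
        { refl  = (id , id) , (id , id)
        ; sym   = λ (p , q) → swap p , swap q
        ; trans = λ ((a , b) , (c , d)) ((a′ , b′) , (c′ , d′)) →
                    (a′ ∘ a , b ∘ b′) , (c′ ∘ c , d ∘ d′)
        }
      ; reflexive = λ ((P⊆Q , _) , _) → P⊆Q
      ; trans     = λ P⊆Q Q⊆R → Q⊆R ∘ P⊆Q
      }
    ; antisym = λ {P} {Q} P⊆Q Q⊆P →
        (P⊆Q , Q⊆P) , (antitone Q P Q⊆P , antitone P Q P⊆Q)
    }
  }
  where
  open MaximalOrthogonalPair using (Y≐X⊥)

  antitone : (P Q : MaximalOrthogonalPair _⟶_) → X P ⊆ X Q → Y Q ⊆ Y P
  antitone P Q P⊆Q y∈Q =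
    proj₂ (Y≐X⊥ P) (λ x x∈P → proj₁ (Y≐X⊥ Q) y∈Q x (P⊆Q x∈P))

Interval : ∀ {c ℓ₁ ℓ₂} (L : Poset c ℓ₁ ℓ₂) (a b : Poset.Carrier L) →
           Poset (c ⊔ ℓ₂) ℓ₁ ℓ₂
Interval L a b = On.poset {B = Σ Carrier λ p → a ≤ p × p ≤ b} L proj₁
  where open Poset L using (Carrier; _≤_)

------------------------------------------------------------------------
-- Factorization systems

Fact : {S : Set ℓ} → Rel S ℓ → Rel S ℓ × Rel S ℓ
Fact _⟶_ = (λ x y → ∀ z → y ⟶ z → x ⟶ z)
         , (λ x y → ∀ z → z ⟶ x → z ⟶ y)

Mult : {S : Set ℓ} → Rel S ℓ → Rel S ℓ → Rel S ℓ
Mult _↠_ _↪_ = _↠_ ; _↪_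

record IsFactorizationSystem {S : Set ℓ} (_⟶_ _↠_ _↪_ : Rel S ℓ) : Set ℓ where
  field
    ⟶-refl : Reflexive _⟶_
    fact-↠ : proj₁ (Fact _⟶_) ⇔ _↠_
    fact-↪ : proj₂ (Fact _⟶_) ⇔ _↪_
    mult   : Mult _↠_ _↪_ ⇔ _⟶_

record IsTwoAcyclicFactorizationSystem
         {S : Set ℓ} (_⟶_ _↠_ _↪_ : Rel S ℓ) : Set ℓ where
  field
    isFactorizationSystem : IsFactorizationSystem _⟶_ _↠_ _↪_
    order-↠               : Antisymmetric _≡_ _↠_
    order-↪               : Antisymmetric _≡_ _↪_
    brick                 : ∀ {x y} → x ↠ y → y ↪ x → x ≡ y

------------------------------------------------------------------------
-- Restriction to a subset

-- Membership proofs in a Refinement are irrelevant, so two elements of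
-- Subset T are equal as soon as their underlying elements of S are.
Subset : {S : Set ℓ} → Pred S ℓ → Set ℓ
Subset {S = S} T = Refinement S T

restrict : {S : Set ℓ} → Rel S ℓ → (T : Pred S ℓ) → Rel (Subset T) ℓ
restrict _⟶_ T = _⟶_ on value

-- For U ⊆ T, the set U regarded as a subset of T.
within : {S : Set ℓ} (T : Pred S ℓ) → Pred S ℓ → Pred (Subset T) ℓ
within T U = U ∘ value

{-# OPTIONS --safe #-}
-- Every arrow x ⟶ y factors as x ↠ w ↪ y, and first components of maximal
-- orthogonal pairs are closed under ↠ while second components are closed under
-- ↪ backwards.  So the middle point w inherits membership in X from x and in Y
-- from y.  This puts w in T = X₂ ∩ Y₁ whenever needed, which gives
-- factorizations inside T and lets orthogonality be tested inside T.

module Submission where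

open import Defs
open import Data.Irrelevant using ([_])
open import Data.Empty using (⊥-elim-irr)
open import Data.Product using (Σ; ∃; _×_; _,_; proj₁; proj₂)
open import Data.Refinement using (value; value-injective) renaming (_,_ to _,ᵣ_)
open import Function using (_∘_; id)
open import Relation.Binary using (Rel; Poset; Transitive)
open import Relation.Binary.Morphism.Structures using (IsOrderIsomorphism)
open import Relation.Binary.PropositionalEquality using (_≡_; refl; sym; subst)
open import Relation.Nullary using (¬_)
open import Relation.Unary using (Pred; _∈_; _⊆_; _∩_)

open MaximalOrthogonalPair using (Y≐X⊥; X≐⊥Y)

-- Orthogonal pairs of an arbitrary relation

module _ {ℓ} {S : Set ℓ} {_⟶_ : Rel S ℓ} where

  orthogonal : (P : MaximalOrthogonalPair _⟶_) →
               ∀ {x y} → x ∈ X P → y ∈ Y P → ¬ (x ⟶ y)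
  orthogonal P x∈X y∈Y = proj₁ (Y≐X⊥ P) y∈Y _ x∈X

  Y-antitone : (P Q : MaximalOrthogonalPair _⟶_) → X P ⊆ X Q → Y Q ⊆ Y P
  Y-antitone P Q P⊆Q y∈Q =
    proj₂ (Y≐X⊥ P) λ x x∈P → orthogonal Q (P⊆Q x∈P) y∈Q

  -- `X P` is a left perp, hence a negative condition, so irrelevant evidence suffices. This
  -- recovers the membership proofs that `Subset T` keeps only irrelevantly.
  X-recompute : (P : MaximalOrthogonalPair _⟶_) → ∀ {x} → .(x ∈ X P) → x ∈ X P
  X-recompute P x∈X =
    proj₂ (X≐⊥Y P) λ y y∈Y x⟶y → ⊥-elim-irr (orthogonal P x∈X y∈Y x⟶y)

  Y-recompute : (P : MaximalOrthogonalPair _⟶_) → ∀ {y} → .(y ∈ Y P) → y ∈ Y P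
  Y-recompute P y∈Y =
    proj₂ (Y≐X⊥ P) λ x x∈X x⟶y → ⊥-elim-irr (orthogonal P x∈X y∈Y x⟶y)

-- Arrows and closure in a two-acyclic system

module FactorizationSystem
  {ℓ} {S : Set ℓ} {_⟶_ _↠_ _↪_ : Rel S ℓ}
  (isTwoAcyclic : IsTwoAcyclicFactorizationSystem _⟶_ _↠_ _↪_)
  where

  open IsTwoAcyclicFactorizationSystem isTwoAcyclic public
  open IsFactorizationSystem isFactorizationSystem public

  ↠-⟶ : ∀ {x y z} → x ↠ y → y ⟶ z → x ⟶ z
  ↠-⟶ x↠y = proj₂ fact-↠ x↠y _

  ⟶-↪ : ∀ {x y z} → x ⟶ y → y ↪ z → x ⟶ z
  ⟶-↪ x⟶y y↪z = proj₂ fact-↪ y↪z _ x⟶y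

  ↠⇒⟶ : ∀ {x y} → x ↠ y → x ⟶ y
  ↠⇒⟶ x↠y = ↠-⟶ x↠y ⟶-refl

  ↪⇒⟶ : ∀ {x y} → x ↪ y → x ⟶ y
  ↪⇒⟶ = ⟶-↪ ⟶-refl

  ↠-trans : Transitive _↠_
  ↠-trans x↠y y↠z = proj₁ fact-↠ λ _ → ↠-⟶ x↠y ∘ ↠-⟶ y↠z

  ↪-trans : Transitive _↪_
  ↪-trans x↪y y↪z = proj₁ fact-↪ λ _ x⟶z → ⟶-↪ (⟶-↪ x⟶z x↪y) y↪z

  factor : ∀ {x y} → x ⟶ y → ∃ λ w → x ↠ w × w ↪ y
  factor = proj₂ mult

  -- Factoring the return arrow as `y ↠ w ↪ x` gives `x ↠ w ↪ x`. The brick condition forces `w` to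
  -- be `x`, and the order condition finishes.
  ↠⟵⇒≡ : ∀ {x y} → x ↠ y → y ⟶ x → x ≡ y
  ↠⟵⇒≡ x↠y y⟶x with w , y↠w , w↪x ← factor y⟶x
    with refl ← brick (↠-trans x↠y y↠w) w↪x = order-↠ x↠y y↠w

  ↪⟵⇒≡ : ∀ {x y} → x ↪ y → y ⟶ x → x ≡ y
  ↪⟵⇒≡ x↪y y⟶x with w , y↠w , w↪x ← factor y⟶x
    with refl ← brick y↠w (↪-trans w↪x x↪y) = order-↪ x↪y w↪x

  module _ (P : MaximalOrthogonalPair _⟶_) where

    X-↠-closed : ∀ {x y} → x ↠ y → x ∈ X P → y ∈ X P
    X-↠-closed x↠y x∈X = proj₂ (X≐⊥Y P) λ _ z∈Y → orthogonal P x∈X z∈Y ∘ ↠-⟶ x↠y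

    Y-↪-closed : ∀ {x y} → x ↪ y → y ∈ Y P → x ∈ Y P
    Y-↪-closed x↪y y∈Y =
      proj₂ (Y≐X⊥ P) λ _ z∈X z⟶x → orthogonal P z∈X y∈Y (⟶-↪ z⟶x x↪y)

-- Two-acyclicity of the restriction to `T`

module IntervalRestriction
  {ℓ} {S : Set ℓ} {_⟶_ _↠_ _↪_ : Rel S ℓ}
  (isTwoAcyclic : IsTwoAcyclicFactorizationSystem _⟶_ _↠_ _↪_)
  (P₁ P₂ : MaximalOrthogonalPair _⟶_)
  (P₁≤P₂ : Poset._≤_ (Pairs _⟶_) P₁ P₂)
  where

  open FactorizationSystem isTwoAcyclic

  T : Pred S ℓ
  T = X P₂ ∩ Y P₁

  _⟶′_ _↠′_ _↪′_ : Rel (Subset T) ℓ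
  _⟶′_ = restrict _⟶_ T
  _↠′_ = proj₁ (Fact _⟶′_)
  _↪′_ = proj₂ (Fact _⟶′_)

  I : Poset _ _ _
  I = Interval (Pairs _⟶_) P₁ P₂

  L′ : Poset _ _ _
  L′ = Pairs _⟶′_

  module I = Poset I
  module L′ = Poset L′

  value∈X₂ : (t : Subset T) → value t ∈ X P₂
  value∈X₂ (_ ,ᵣ [ x∈T ]) = X-recompute P₂ (proj₁ x∈T)

  value∈Y₁ : (t : Subset T) → value t ∈ Y P₁
  value∈Y₁ (_ ,ᵣ [ x∈T ]) = Y-recompute P₁ (proj₂ x∈T)

  factor′ : {x y : Subset T} → x ⟶′ y →
            ∃ λ (w : Subset T) → value x ↠ value w × value w ↪ value y
  factor′ {x} {y} x⟶y with w , x↠w , w↪y ← factor x⟶y =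
    (w ,ᵣ [ X-↠-closed P₂ x↠w (value∈X₂ x) , Y-↪-closed P₁ w↪y (value∈Y₁ y) ]) ,
    x↠w , w↪y

  ↠′⇒⟶ : {x y : Subset T} → x ↠′ y → value x ⟶ value y
  ↠′⇒⟶ {y = y} x↠y = x↠y y ⟶-refl

  ↪′⇒⟶ : {x y : Subset T} → x ↪′ y → value x ⟶ value y
  ↪′⇒⟶ {x} x↪y = x↪y x ⟶-refl

  -- Carries cycles of primed relations back to `S`, where two-acyclicity is known. The middle point
  -- `w` of `x ⟶ y` lies in `T`, so `y ↠′ x` can be tested at `w`: it gives `y ⟶ w`, and with
  -- `w ↪ y` this collapses `w` to `y`.
  ⟶∧↠′⇒↠ : {x y : Subset T} → x ⟶′ y → y ↠′ x → value x ↠ value y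
  ⟶∧↠′⇒↠ {x} {y} x⟶y y↠x with w , x↠w , w↪y ← factor′ {x} {y} x⟶y =
    subst (value x ↠_) (↪⟵⇒≡ w↪y (y↠x w (↠⇒⟶ x↠w))) x↠w

  ⟶∧↪′⇒↪ : {x y : Subset T} → x ⟶′ y → y ↪′ x → value x ↪ value y
  ⟶∧↪′⇒↪ {x} {y} x⟶y y↪x with w , x↠w , w↪y ← factor′ {x} {y} x⟶y =
    subst (_↪ value y) (sym (↠⟵⇒≡ x↠w (y↪x w (↪⇒⟶ w↪y)))) w↪y

  restrict-isTwoAcyclic : IsTwoAcyclicFactorizationSystem _⟶′_ _↠′_ _↪′_
  restrict-isTwoAcyclic = record
    { isFactorizationSystem = record
      { ⟶-refl = ⟶-refl
      ; fact-↠ = id , id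
      ; fact-↪ = id , id
      ; mult   =
          (λ {_} {z} (y , x↠y , y↪z) → x↠y z (↪′⇒⟶ {y} {z} y↪z)) ,
          (λ {x} {z} x⟶z → let y , x↠y , y↪z = factor′ {x} {z} x⟶z in
            y , (λ _ → ↠-⟶ x↠y) , (λ _ w⟶y → ⟶-↪ w⟶y y↪z))
      }
    ; order-↠ = λ {x} {y} x↠y y↠x → value-injective
        (order-↠ (⟶∧↠′⇒↠ {x} {y} (↠′⇒⟶ {x} {y} x↠y) y↠x)
                 (⟶∧↠′⇒↠ {y} {x} (↠′⇒⟶ {y} {x} y↠x) x↠y))
    ; order-↪ = λ {x} {y} x↪y y↪x → value-injective
        (order-↪ (⟶∧↪′⇒↪ {x} {y} (↪′⇒⟶ {x} {y} x↪y) y↪x)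
                 (⟶∧↪′⇒↪ {y} {x} (↪′⇒⟶ {y} {x} y↪x) x↪y))
    -- Each hypothesis supplies the arrow needed to transfer the other, so the cycle obtained in `S`
    -- is the reversed one, `y ↠ x ↪ y`.
    ; brick = λ {x} {y} x↠y y↪x → value-injective
        (sym (brick (⟶∧↠′⇒↠ {y} {x} (↪′⇒⟶ {y} {x} y↪x) x↠y)
                    (⟶∧↪′⇒↪ {x} {y} (↠′⇒⟶ {x} {y} x↠y) y↪x)))
    }

  -- The isomorphism from the interval

  toX toY : I.Carrier → Pred (Subset T) ℓ
  toX (P , _) = within T (X P ∩ Y P₁)
  toY (P , _) = within T (Y P ∩ X P₂)

  to-isMaximal : (P : I.Carrier) → IsMaximalOrthogonalPair _⟶′_ (toX P) (toY P)
  to-isMaximal (P , P₁≤P , P≤P₂) = record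
    { Y≐X⊥ =
        (λ (y∈Y , _) _ (x∈X , _) → orthogonal P x∈X y∈Y) ,
        (λ {y} y∈X⊥ →
          -- The source of the arrow may lie outside `T`; the middle point `w` replaces it, being in
          -- `T` and in `X P` with an arrow to `y`.
          proj₂ (Y≐X⊥ P) (λ _ x∈X x⟶y →
            let w , x↠w , w↪y = factor x⟶y
                w∈X  = X-↠-closed P x↠w x∈X
                w∈Y₁ = Y-↪-closed P₁ w↪y (value∈Y₁ y)
            in y∈X⊥ (w ,ᵣ [ P≤P₂ w∈X , w∈Y₁ ]) (w∈X , w∈Y₁) (↪⇒⟶ w↪y)) ,
          value∈X₂ y)
    ; X≐⊥Y =
        (λ (x∈X , _) _ (y∈Y , _) → orthogonal P x∈X y∈Y) ,
        (λ {x} x∈⊥Y →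
          proj₂ (X≐⊥Y P) (λ _ y∈Y x⟶y →
            let w , x↠w , w↪y = factor x⟶y
                w∈Y  = Y-↪-closed P w↪y y∈Y
                w∈X₂ = X-↠-closed P₂ x↠w (value∈X₂ x)
            in x∈⊥Y (w ,ᵣ [ w∈X₂ , Y-antitone P₁ P P₁≤P w∈Y ]) (w∈Y , w∈X₂)
                    (↠⇒⟶ x↠w)) ,
          value∈Y₁ x)
    }

  to : I.Carrier → L′.Carrier
  to P = mkPair (toX P) (toY P) (to-isMaximal P)

  to-mono : ∀ {P Q} → P I.≤ Q → to P L′.≤ to Q
  to-mono P≤Q (x∈P , x∈Y₁) = P≤Q x∈P , x∈Y₁

  -- An arrow from `X P` to `Y Q` would have its middle point in `T`, in `X P` and in `Y Q`. The
  -- hypothesis puts that point in `X Q` too, so its loop contradicts orthogonality.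
  to-cancel : ∀ {P Q} → to P L′.≤ to Q → P I.≤ Q
  to-cancel {P , _ , P≤P₂} {Q , P₁≤Q , _} toP≤toQ x∈P =
    proj₂ (X≐⊥Y Q) λ _ y∈Q x⟶y →
      let w , x↠w , w↪y = factor x⟶y
          w∈P  = X-↠-closed P x↠w x∈P
          w∈Q  = Y-↪-closed Q w↪y y∈Q
          w∈Y₁ = Y-antitone P₁ Q P₁≤Q w∈Q
          w∈XQ = proj₁ (toP≤toQ {w ,ᵣ [ P≤P₂ w∈P , w∈Y₁ ]} (w∈P , w∈Y₁))
      in orthogonal Q w∈XQ w∈Q ⟶-refl

  module _ (Q : L′.Carrier) where

    -- ⊥(Y Q ∪ Y P₂), the largest first component that can restrict to X Q.
    fromX : Pred S ℓ
    fromX x = x ∈ X P₂ × (∀ t → t ∈ Y Q → ¬ (x ⟶ value t))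

    from : I.Carrier
    from =
      mkPair fromX (rightPerp _⟶_ fromX) (record
        { Y≐X⊥ = id , id
        ; X≐⊥Y =
            (λ x∈U _ y∈U⊥ → y∈U⊥ _ x∈U) ,
            -- `Y P₂` and the points of `Y Q` all lie in the right perp of `fromX`, so being
            -- orthogonal to that perp gives both conditions of `fromX`.
            (λ x∈⊥U⊥ →
              proj₂ (X≐⊥Y P₂) (λ y y∈Y₂ →
                x∈⊥U⊥ y λ _ (u∈X₂ , _) → orthogonal P₂ u∈X₂ y∈Y₂) ,
              (λ t t∈Q → x∈⊥U⊥ (value t) λ _ (_ , u⟶̸) → u⟶̸ t t∈Q))
        }) ,
      (λ x∈X₁ → P₁≤P₂ x∈X₁ , λ t _ → orthogonal P₁ x∈X₁ (value∈Y₁ t)) ,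
      proj₁

    -- Points of `T` lie in `X P₂` and `Y P₁`, so `fromX` cuts out in `T` exactly the left perp of
    -- `Y Q` under `⟶′`, which is `X Q`.
    to-from : to from L′.≈ Q
    to-from = L′.antisym {to from} {Q}
      (λ ((_ , x⟶̸) , _) → proj₂ (X≐⊥Y Q) x⟶̸)
      (λ {x} x∈Q → (value∈X₂ x , proj₁ (X≐⊥Y Q) x∈Q) , value∈Y₁ x)

  to-cong : ∀ {P Q} → P I.≈ Q → to P L′.≈ to Q
  to-cong {P} {Q} ((P⊆Q , Q⊆P) , _) = L′.antisym {to P} {to Q}
    (λ {x} → to-mono {P} {Q} P⊆Q {x})
    (λ {x} → to-mono {Q} {P} Q⊆P {x})

  to-injective : ∀ {P Q} → to P L′.≈ to Q → P I.≈ Q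
  to-injective {P} {Q} ((toP⊆toQ , toQ⊆toP) , _) = I.antisym {P} {Q}
    (to-cancel {P} {Q} (λ {x} → toP⊆toQ {x}))
    (to-cancel {Q} {P} (λ {x} → toQ⊆toP {x}))

  to-isOrderIsomorphism : IsOrderIsomorphism I._≈_ L′._≈_ I._≤_ L′._≤_ to
  to-isOrderIsomorphism = record
    { isOrderMonomorphism = record
      { isOrderHomomorphism = record
        { cong = λ {P} {Q} → to-cong {P} {Q}
        ; mono = λ {P} {Q} → to-mono {P} {Q}
        }
      ; injective = λ {P} {Q} → to-injective {P} {Q}
      ; cancel    = λ {P} {Q} → to-cancel {P} {Q}
      }
    ; surjective = λ Q → from Q , λ {P} P≈ →
        L′.Eq.trans {to P} {to (from Q)} {Q} (to-cong {P} {from Q} P≈) (to-from Q)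
    }

theorem4p3 :
  ∀ {ℓ} {S : Set ℓ} (_⟶_ _↠_ _↪_ : Rel S ℓ) →
  IsTwoAcyclicFactorizationSystem _⟶_ _↠_ _↪_ →
  (P₁ P₂ : MaximalOrthogonalPair _⟶_) →
  Poset._≤_ (Pairs _⟶_) P₁ P₂ →
  let T    = X P₂ ∩ Y P₁
      _⟶′_ = restrict _⟶_ T
      I    = Interval (Pairs _⟶_) P₁ P₂
      L′   = Pairs _⟶′_
  in
  IsTwoAcyclicFactorizationSystem _⟶′_ (proj₁ (Fact _⟶′_)) (proj₂ (Fact _⟶′_))
  ×
  (Σ ((P : Poset.Carrier I) →
       IsMaximalOrthogonalPair _⟶′_
         (within T (X (proj₁ P) ∩ Y P₁))
         (within T (Y (proj₁ P) ∩ X P₂)))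
     λ isMax →
       IsOrderIsomorphism (Poset._≈_ I) (Poset._≈_ L′) (Poset._≤_ I) (Poset._≤_ L′)
         (λ P → mkPair (within T (X (proj₁ P) ∩ Y P₁))
                       (within T (Y (proj₁ P) ∩ X P₂))
                       (isMax P)))
theorem4p3 _⟶_ _↠_ _↪_ isTwoAcyclic P₁ P₂ P₁≤P₂ =
  restrict-isTwoAcyclic , to-isMaximal , to-isOrderIsomorphism
  where open IntervalRestriction isTwoAcyclic P₁ P₂ P₁≤P₂
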